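{- The following problem is decidable: given a finite alphabet $\mathcal{A}$, a finite set $\mathcal{F}$ of finite patterns on $\mathbb{Z}^d$, and $T\in\mathbb{N}$, does player $A$ have a strategy to win the game $\Gamma(\mathcal{A},\mathcal{F},\mathbb{Z}^d)$ in $T$ moves or less (i.e. is the game value of $\Gamma(\mathcal{A},\mathcal{F},\mathbb{Z}^d)$ at most $T$)?
   Context: Fix $d\ge 1$. A pattern is $p=(S,f)$ with $S\subseteq\mathbb{Z}^d$ and $f\in\mathcal{A}^S$. A finite pattern $q=(S',g)$ appears in $p=(S,f)$ if there is $v\in\mathbb{Z}^d$ with $v+S'\subseteq S$ and $f(v+j)=g(j)$ for all $j\in S'$. The Domino game $\Gamma(\mathcal{A},\mathcal{F},E)$ for $E\subseteq\mathbb{Z}^d$: players $A$ and $B$ alternate turns, $A$ first, starting from the empty pattern; on a turn the current player passes or colours one uncoloured cell of $E$ with a colour of $\mathcal{A}$. A position $(p,\rho)$ is final if a pattern of $\mathcal{F}$ appears in $p$, and then $A$ wins; $B$ wins if no final position occurs. Values are defined inductively: a final position has value $0$; a position with $A$ to move that has a move to a position winning for $A$ is winning for $A$ with value $1+\min$ of the values of such successors; a position with $B$ to move all of whose successors are winning for $A$ is winning for $A$ with value $1+\sup$ of the successor values. "$A$ wins in $T$ moves or less" means the initial position (empty pattern, $A$ to move) is winning for $A$ with value $\le T$, i.e. $A$ has a strategy guaranteeing a final position within $T$ turns (turns of both players counted). -}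

module Defs where

open import Data.Bool using (if_then_else_)
open import Data.Integer using (ℤ)
import Data.Integer as ℤ
open import Data.List using (List; map)
open import Data.List.Relation.Unary.All using (All)
open import Data.List.Relation.Unary.Any using (Any)
open import Data.List.Relation.Unary.Unique.Propositional using (Unique)
open import Data.Maybe using (Maybe; just; nothing)
open import Data.Nat using (ℕ; suc)
open import Data.Product using (_×_; _,_; proj₁; ∃-syntax)
open import Data.Vec using (Vec; zipWith)
open import Data.Vec.Properties using (≡-dec)
open import Level using (0ℓ)
open import Relation.Binary using (DecidableEquality)
open import Relation.Binary.PropositionalEquality using (_≡_)
open import Relation.Nullary using (does)
open import Relation.Unary using (Pred; _∈_)

Cell : ℕ → Set
Cell d = Vec ℤ d

infixl 6 _⊕_
_⊕_ : ∀ {d} → Cell d → Cell d → Cell d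
_⊕_ = zipWith ℤ._+_

_≟ᶜ_ : ∀ {d} → DecidableEquality (Cell d)
_≟ᶜ_ = ≡-dec ℤ._≟_

-- A pattern (S , f) is the partial function that is `just (f x)` on S
-- and `nothing` (uncoloured) off S.
Pattern : ℕ → Set → Set
Pattern d A = Cell d → Maybe A

empty : ∀ {d A} → Pattern d A
empty _ = nothing

_[_≔_] : ∀ {d A} → Pattern d A → Cell d → A → Pattern d A
(p [ x ≔ c ]) y = if does (y ≟ᶜ x) then just c else p y

-- A finite pattern (S' , g), given by listing the graph of g; uniqueness of the
-- listed cells says that the list is the graph of a function.
record FinitePattern (d : ℕ) (A : Set) : Set where
  field
    graph      : List (Cell d × A)
    functional : Unique (map proj₁ graph)

open FinitePattern public

_AppearsIn_ : ∀ {d A} → FinitePattern d A → Pattern d A → Set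
_AppearsIn_ {d} q p =
  ∃[ v ] All (λ (j , c) → p (v ⊕ j) ≡ just c) (graph q)

data Player : Set where
  A B : Player

Position : ℕ → Set → Set
Position d 𝒜 = Pattern d 𝒜 × Player

module Γ {d : ℕ} (𝒜 : Set) (ℱ : List (FinitePattern d 𝒜)) (E : Pred (Cell d) 0ℓ) where

  data Move (p : Pattern d 𝒜) : Pattern d 𝒜 → Set where
    pass   : Move p p
    colour : ∀ x c → x ∈ E → p x ≡ nothing → Move p (p [ x ≔ c ])

  Final : Pattern d 𝒜 → Set
  Final p = Any (_AppearsIn p) ℱ

  -- `Value≤ n s`: the position s is winning for A with value at most n.
  -- The bound 1 + min ≤ 1 + n says that some successor has value at most n, and
  -- 1 + sup ≤ 1 + n that all of them do. The last two constructors need not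
  -- exclude final positions, which have value 0 and so satisfy every bound.
  data Value≤ : ℕ → Position d 𝒜 → Set where
    final : ∀ {n p ρ} → Final p → Value≤ n (p , ρ)
    moveA : ∀ {n p p′} → Move p p′ → Value≤ n (p′ , B) → Value≤ (suc n) (p , A)
    moveB : ∀ {n p} → (∀ {p′} → Move p p′ → Value≤ n (p′ , A)) → Value≤ (suc n) (p , B)

  AWinsWithin : ℕ → Set
  AWinsWithin T = Value≤ T (empty , A)

{-# OPTIONS --safe #-}
-- Colourings reachable in the game have finitely many coloured cells x₁ … xₙ, and both
-- "a pattern of ℱ appears" and "this cell is uncoloured" are first-order conditions on these
-- cells in the structure ℤᵈ with equality and the translations x ↦ x ⊕ t. For a fixed number
-- of remaining turns, so is "A wins": each turn of the game is one quantifier over cells.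
-- This structure has effective quantifier elimination: in ∃ x. φ, either x equals one of
-- the finitely many terms that φ compares it with, or x differs from all of them, in which
-- case every such comparison is false; cells of the latter kind exist because ℤᵈ is infinite.
module Submission where

open import Algebra.Bundles using (Group)
import Algebra.Properties.Group as GroupProperties
open import Data.Bool using (Bool; false; not; _∧_; _∨_)
open import Data.Fin using (Fin; zero; suc)
import Data.Fin as Fin
open import Data.Integer using (+_; -_; ∣_∣)
import Data.Integer.Properties as ℤ
open import Data.List using (List; []; _∷_; _++_; allFin)
import Data.List as List
open import Data.List.Extrema.Nat using (max; xs≤max)
open import Data.List.Membership.Propositional using (lose)
open import Data.List.Membership.Propositional.Properties using (∈-allFin)
open import Data.List.Relation.Unary.All using (All; []; _∷_)
import Data.List.Relation.Unary.All as All
import Data.List.Relation.Unary.All.Properties as All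
open import Data.List.Relation.Unary.Any using (Any; any?)
import Data.List.Relation.Unary.Any as Any
open import Data.Maybe using (Maybe; just; nothing)
open import Data.Maybe.Properties using (≡-dec)
open import Data.Nat using (ℕ; zero; suc; _≤_; _≥_; s≤s)
open import Data.Nat.Properties using (1+n≰n)
open import Data.Product using (_×_; _,_; ∃-syntax)
open import Data.Sum using (_⊎_; inj₁; inj₂; [_,_]′)
open import Data.Unit using (tt)
open import Data.Vec using (Vec; []; _∷_; head; tail; lookup; replicate; map)
open import Data.Vec.Properties
  using (zipWith-assoc; zipWith-identityˡ; zipWith-identityʳ; zipWith-inverseˡ; zipWith-inverseʳ)
open import Function using (_∘_; _⇔_; mk⇔)
open import Function.Construct.Identity using (⇔-id)
open import Level using (0ℓ)
open import Relation.Binary.PropositionalEquality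
  using (_≡_; _≢_; refl; sym; trans; cong; cong₂; subst; isEquivalence)
open import Relation.Nullary
  using (Dec; yes; no; does; proof; _because_; Reflects; ¬_; contradiction)
open import Relation.Nullary.Decidable using (dec-false; does-⇔; decidable-stable)
import Relation.Nullary.Decidable as Dec
open import Relation.Nullary.Reflects
  using (ofʸ; ofⁿ; ¬-reflects; _×-reflects_; _⊎-reflects_; _→-reflects_)
open import Relation.Unary using (Pred; U)
open import Defs

private
  variable
    d k m n : ℕ

-- The group ℤᵈ of cells and translations.

cellGroup : ℕ → Group 0ℓ 0ℓ
cellGroup d = record
  { Carrier = Cell d
  ; _≈_     = _≡_
  ; _∙_     = _⊕_
  ; ε       = replicate d (+ 0)
  ; _⁻¹     = map (-_)
  ; isGroup = record
    { isMonoid = record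
      { isSemigroup = record
        { isMagma = record { isEquivalence = isEquivalence ; ∙-cong = cong₂ _⊕_ }
        ; assoc   = zipWith-assoc ℤ.+-assoc
        }
      ; identity = zipWith-identityˡ ℤ.+-identityˡ , zipWith-identityʳ ℤ.+-identityʳ
      }
    ; inverse = zipWith-inverseˡ ℤ.+-inverseˡ , zipWith-inverseʳ ℤ.+-inverseʳ
    ; ⁻¹-cong = cong (map (-_))
    }
  }

module _ {d : ℕ} where
  open Group (cellGroup d) public
    using () renaming (ε to 𝟎; _⁻¹ to ⊖_; assoc to ⊕-assoc; identityʳ to ⊕-identityʳ)
  open GroupProperties (cellGroup d) public
    using (x≈z//y; identityʳ-unique; //-rightDividesˡ)

  ⊕-move : (x y t : Cell d) → (x ⊕ t ≡ y) ⇔ (x ≡ y ⊕ ⊖ t)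
  ⊕-move x y t = mk⇔ (x≈z//y x t y) λ { refl → //-rightDividesˡ t y }

-- One more than the largest absolute value of a first coordinate cannot be the first coordinate of
-- a listed cell. This is where positive dimension enters.
fresh : (xs : List (Cell (suc d))) → ∃[ x ] All (x ≢_) xs
fresh xs = replicate _ (+ suc bound) , All.map outside (All.map⁻ (xs≤max 0 sizes))
  where
  sizes : List ℕ
  sizes = List.map (∣_∣ ∘ head) xs
  bound : ℕ
  bound = max 0 sizes
  outside : ∀ {y} → ∣ head y ∣ ≤ bound → replicate _ (+ suc bound) ≢ y
  outside y≤bound refl = 1+n≰n y≤bound

reflects-transport : {X Y : Set} {a b : Bool} → a ≡ b → Reflects X a → Reflects Y b → X → Y
reflects-transport refl (ofʸ _)  (ofʸ y) _ = y
reflects-transport refl (ofⁿ ¬x) _       x = contradiction x ¬x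

-- Quantifier elimination over ℤᵈ with translations

Term : ℕ → ℕ → Set
Term d n = Fin n × Cell d

value : Term d n → Vec (Cell d) n → Cell d
value (i , t) ρ = lookup ρ i ⊕ t

var : Fin n → Term d n
var i = i , 𝟎

-- Atoms need a translation on one side only, since ℤᵈ is a group. There is no quantifier
-- constructor: quantifiers are eliminated as they arise, in `definable-∃` and `definable-∀`.
data Formula (d n : ℕ) : Set where
  const   : Bool → Formula d n
  _≐_     : Fin n → Term d n → Formula d n
  combine : (Bool → Bool → Bool) → Formula d n → Formula d n → Formula d n

⟦_⟧ : Formula d n → Vec (Cell d) n → Bool
⟦ const b ⟧       ρ = b
⟦ i ≐ s ⟧         ρ = does (lookup ρ i ≟ᶜ value s ρ)
⟦ combine f φ ψ ⟧ ρ = f (⟦ φ ⟧ ρ) (⟦ ψ ⟧ ρ)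

substitute : (Fin m → Term d n) → Formula d m → Formula d n
substitute σ (const b)       = const b
substitute σ (i ≐ (j , t))   =
  let (i′ , u) = σ i
      (j′ , w) = σ j
  -- The translation `u` that comes with the left-hand variable is moved to the right.
  in i′ ≐ (j′ , w ⊕ t ⊕ ⊖ u)
substitute σ (combine f φ ψ) = combine f (substitute σ φ) (substitute σ ψ)

substitute-sound : (σ : Fin m → Term d n) (ρ : Vec (Cell d) n) (ρ′ : Vec (Cell d) m) →
  (∀ i → lookup ρ′ i ≡ value (σ i) ρ) → (φ : Formula d m) →
  ⟦ φ ⟧ ρ′ ≡ ⟦ substitute σ φ ⟧ ρ
substitute-sound σ ρ ρ′ eq (const b) = refl
substitute-sound σ ρ ρ′ eq (i ≐ (j , t)) rewrite eq i | eq j =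
  let (i′ , u) = σ i
      (j′ , w) = σ j
      x = lookup ρ i′
      y = lookup ρ j′
      reassoc : y ⊕ w ⊕ t ⊕ ⊖ u ≡ y ⊕ (w ⊕ t ⊕ ⊖ u)
      reassoc = trans (cong (_⊕ ⊖ u) (⊕-assoc y w t)) (⊕-assoc y (w ⊕ t) (⊖ u))
  in does-⇔ (subst (λ z → (x ⊕ u ≡ y ⊕ w ⊕ t) ⇔ (x ≡ z)) reassoc
               (⊕-move x (y ⊕ w ⊕ t) u))
            ((x ⊕ u) ≟ᶜ (y ⊕ w ⊕ t)) (x ≟ᶜ (y ⊕ (w ⊕ t ⊕ ⊖ u)))
substitute-sound σ ρ ρ′ eq (combine f φ ψ) =
  cong₂ f (substitute-sound σ ρ ρ′ eq φ) (substitute-sound σ ρ ρ′ eq ψ)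

-- These terms in the remaining variables are the values of variable `zero` at which an atom
-- comparing it with another variable holds. An atom `zero ≐ (zero , t)` gives none, as its truth
-- does not depend on that variable.
roots : Formula d (suc n) → List (Term d n)
roots (const b)               = []
roots (zero  ≐ (zero  , t))   = []
roots (zero  ≐ (suc j , t))   = (j , t) ∷ []
roots (suc i ≐ (zero  , t))   = (i , ⊖ t) ∷ []
roots (suc i ≐ (suc j , t))   = []
roots (combine f φ ψ)         = roots φ ++ roots ψ

atGeneric : Formula d (suc n) → Formula d n
atGeneric (const b)             = const b
atGeneric (zero  ≐ (zero  , t)) = const (does (t ≟ᶜ 𝟎))
atGeneric (zero  ≐ (suc j , t)) = const false
atGeneric (suc i ≐ (zero  , t)) = const false
atGeneric (suc i ≐ (suc j , t)) = i ≐ (j , t)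
atGeneric (combine f φ ψ)       = combine f (atGeneric φ) (atGeneric ψ)

-- Away from the roots, every atom comparing `x` with another variable is false, while `x ≡ x ⊕ t`
-- amounts to `t ≡ 𝟎`.
atGeneric-sound : (φ : Formula d (suc n)) (ρ : Vec (Cell d) n) (x : Cell d) →
  All (λ s → x ≢ value s ρ) (roots φ) → ⟦ φ ⟧ (x ∷ ρ) ≡ ⟦ atGeneric φ ⟧ ρ
atGeneric-sound (const b) ρ x _ = refl
atGeneric-sound (zero ≐ (zero , t)) ρ x _ =
  does-⇔ (mk⇔ (identityʳ-unique x t ∘ sym) λ { refl → sym (⊕-identityʳ x) })
         (x ≟ᶜ (x ⊕ t)) (t ≟ᶜ 𝟎)
atGeneric-sound (zero ≐ (suc j , t)) ρ x (x≢ ∷ []) = dec-false (x ≟ᶜ (lookup ρ j ⊕ t)) x≢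
atGeneric-sound (suc i ≐ (zero , t)) ρ x (x≢ ∷ []) =
  dec-false (lookup ρ i ≟ᶜ (x ⊕ t)) (x≢ ∘ x≈z//y x t (lookup ρ i) ∘ sym)
atGeneric-sound (suc i ≐ (suc j , t)) ρ x _ = refl
atGeneric-sound (combine f φ ψ) ρ x x≢ =
  cong₂ f (atGeneric-sound φ ρ x (All.++⁻ˡ (roots φ) x≢))
          (atGeneric-sound ψ ρ x (All.++⁻ʳ (roots φ) x≢))

-- Definable predicates

record Definable {d n : ℕ} (P : Pred (Vec (Cell d) n) 0ℓ) : Set where
  constructor _defines_
  field
    formula  : Formula d n
    reflects : ∀ ρ → Reflects (P ρ) (⟦ formula ⟧ ρ)

  decide : ∀ ρ → Dec (P ρ)
  decide ρ = ⟦ formula ⟧ ρ because reflects ρ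

open Definable

private
  variable
    P Q : Pred (Vec (Cell d) n) 0ℓ
    X : Set

definable-⇔ : (∀ ρ → P ρ ⇔ Q ρ) → Definable P → Definable Q
definable-⇔ P⇔Q P-def .formula    = P-def .formula
definable-⇔ P⇔Q P-def .reflects ρ = proof (Dec.map (P⇔Q ρ) (decide P-def ρ))

definable-const : Dec X → Definable {d} {n} λ _ → X
definable-const X? = const (does X?) defines λ _ → proof X?

definable-≡ : (i : Fin n) (s : Term d n) → Definable λ ρ → lookup ρ i ≡ value s ρ
definable-≡ i s = (i ≐ s) defines λ ρ → proof (lookup ρ i ≟ᶜ value s ρ)

definable-¬ : Definable P → Definable λ ρ → ¬ P ρ
definable-¬ (φ defines r) = combine (λ b _ → not b) φ φ defines (¬-reflects ∘ r)

definable-× : Definable P → Definable Q → Definable λ ρ → P ρ × Q ρ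
definable-× (φ defines r) (ψ defines s) = combine _∧_ φ ψ defines λ ρ → r ρ ×-reflects s ρ

definable-⊎ : Definable P → Definable Q → Definable λ ρ → P ρ ⊎ Q ρ
definable-⊎ (φ defines r) (ψ defines s) = combine _∨_ φ ψ defines λ ρ → r ρ ⊎-reflects s ρ

definable-→ : Definable P → Definable Q → Definable λ ρ → P ρ → Q ρ
definable-→ (φ defines r) (ψ defines s) =
  combine (λ a b → not a ∨ b) φ ψ defines λ ρ → r ρ →-reflects s ρ

definable-Any : {P : X → Pred (Vec (Cell d) n) 0ℓ} → (∀ x → Definable (P x)) →
  ∀ xs → Definable λ ρ → Any (λ x → P x ρ) xs
definable-Any P-def [] = definable-⇔ (λ _ → mk⇔ (λ ()) λ ()) (definable-const (no λ x → x))
definable-Any P-def (x ∷ xs) =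
  definable-⇔ (λ _ → mk⇔ Any.fromSum Any.toSum)
    (definable-⊎ (P-def x) (definable-Any P-def xs))

definable-All : {P : X → Pred (Vec (Cell d) n) 0ℓ} → (∀ x → Definable (P x)) →
  ∀ xs → Definable λ ρ → All (λ x → P x ρ) xs
definable-All P-def [] = definable-⇔ (λ _ → mk⇔ (λ _ → []) λ _ → tt) (definable-const (yes tt))
definable-All P-def (x ∷ xs) =
  definable-⇔ (λ _ → mk⇔ (λ (p , ps) → p ∷ ps) All.uncons)
    (definable-× (P-def x) (definable-All P-def xs))

definable-∃Fin : {P : Fin k → Pred (Vec (Cell d) n) 0ℓ} → (∀ c → Definable (P c)) →
  Definable λ ρ → ∃[ c ] P c ρ
definable-∃Fin P-def =
  definable-⇔ (λ _ → mk⇔ Any.satisfied λ (c , p) → lose (∈-allFin c) p)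
    (definable-Any P-def (allFin _))

definable-∀Fin : {P : Fin k → Pred (Vec (Cell d) n) 0ℓ} → (∀ c → Definable (P c)) →
  Definable λ ρ → ∀ c → P c ρ
definable-∀Fin P-def =
  definable-⇔ (λ _ → mk⇔ (λ ps c → All.lookup ps (∈-allFin c)) λ p → All.universal p _)
    (definable-All P-def (allFin _))

definable-substitute : (σ : Fin m → Term d n) (f : Vec (Cell d) n → Vec (Cell d) m) →
  (∀ ρ i → lookup (f ρ) i ≡ value (σ i) ρ) → Definable P → Definable (P ∘ f)
definable-substitute {P = P} σ f eq (φ defines r) =
  substitute σ φ defines λ ρ →
    subst (Reflects (P (f ρ))) (substitute-sound σ ρ (f ρ) (eq ρ) φ) (r (f ρ))

definable-instance : (s : Term d n) → Definable P → Definable λ ρ → P (value s ρ ∷ ρ)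
definable-instance s = definable-substitute
  (λ { zero → s ; (suc i) → var i }) (λ ρ → value s ρ ∷ ρ)
  λ { ρ zero → refl ; ρ (suc i) → sym (⊕-identityʳ (lookup ρ i)) }

-- The roots give a finite disjunction of instances, and one further disjunct stands for all other
-- cells. `fresh` represents these; the cell it returns depends on `ρ`, but the truth value of `φ`
-- there is that of `atGeneric φ`, where the cell no longer occurs.
definable-∃ : {P : Pred (Vec (Cell (suc d)) (suc n)) 0ℓ} →
  Definable P → Definable λ ρ → ∃[ x ] P (x ∷ ρ)
definable-∃ {P = P} P-def@(φ defines r) =
  definable-⇔ (λ ρ → mk⇔ (witness ρ) (split ρ))
    (definable-⊎ (definable-Any (λ s → definable-instance s P-def) (roots φ))
                 (atGeneric φ defines λ ρ → subst (Reflects (Generic ρ)) (generic-eq ρ) (r _)))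
  where
  generic = λ ρ → fresh (List.map (λ s → value s ρ) (roots φ))
  Generic = λ ρ → let (x , _) = generic ρ in P (x ∷ ρ)

  generic-eq : ∀ ρ → let (x , _) = generic ρ in ⟦ φ ⟧ (x ∷ ρ) ≡ ⟦ atGeneric φ ⟧ ρ
  generic-eq ρ = let (x , x≢) = generic ρ in atGeneric-sound φ ρ x (All.map⁻ x≢)

  AtRoot = λ ρ → Any (λ s → P (value s ρ ∷ ρ)) (roots φ)

  witness : ∀ ρ → AtRoot ρ ⊎ Generic ρ → ∃[ x ] P (x ∷ ρ)
  witness ρ (inj₁ p) = let (s , p′) = Any.satisfied p in value s ρ , p′
  witness ρ (inj₂ p) = _ , p

  split : ∀ ρ → ∃[ x ] P (x ∷ ρ) → AtRoot ρ ⊎ Generic ρ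
  split ρ (x , p) with any? (λ s → x ≟ᶜ value s ρ) (roots φ)
  ... | yes x≡ = inj₁ (Any.map (λ eq → subst (λ y → P (y ∷ ρ)) eq p) x≡)
  -- Both `x` and the fresh cell avoid all roots, so `φ` has the same truth value at both and `P`
  -- passes from one to the other.
  ... | no  x≢ = inj₂ (reflects-transport (trans x-eq (sym (generic-eq ρ))) (r _) (r _) p)
    where
    x-eq : ⟦ φ ⟧ (x ∷ ρ) ≡ ⟦ atGeneric φ ⟧ ρ
    x-eq = atGeneric-sound φ ρ x (All.¬Any⇒All¬ _ x≢)

definable-∀ : {P : Pred (Vec (Cell (suc d)) (suc n)) 0ℓ} →
  Definable P → Definable λ ρ → ∀ x → P (x ∷ ρ)
definable-∀ P-def =
  definable-⇔
    -- Reading ∀ as ¬∃¬ is constructively sound here because `P` is decidable.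
    (λ ρ → mk⇔ (λ ¬∃¬ x → decidable-stable (decide P-def (x ∷ ρ)) λ ¬p → ¬∃¬ (x , ¬p))
               (λ p (x , ¬p) → ¬p (p x)))
    (definable-¬ (definable-∃ (definable-¬ P-def)))

-- The game

-- The colours stay outside the formulas, as there are finitely many choices; only the cells become
-- variables. The head is the latest move.
paint : {A : Set} → Vec A n → Vec (Cell d) n → Pattern d A
paint []       []      = empty
paint (c ∷ cs) (x ∷ ρ) = paint cs ρ [ x ≔ c ]

-- Variable `zero` is the translation `v` at which a pattern is placed, and the others are the
-- painted cells. The latest cell either is `v ⊕ j`, which settles the colour, or can be discarded.
definable-colour : (cs : Vec (Fin k) n) (j : Cell d) (m : Maybe (Fin k)) →
  Definable λ ρ → paint cs (tail ρ) (head ρ ⊕ j) ≡ m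
definable-colour [] j m =
  definable-⇔ (λ { (_ ∷ []) → ⇔-id _ })
    (definable-const (≡-dec Fin._≟_ nothing m))
definable-colour (c ∷ cs) j m =
  definable-⇔ (λ { (v ∷ x ∷ ρ) → cases v x ρ })
    (definable-⊎
      (definable-× hit (definable-const (≡-dec Fin._≟_ (just c) m)))
      (definable-× (definable-¬ hit)
        -- This renaming keeps `v` and drops the latest cell.
        (definable-substitute (λ { zero → var zero ; (suc i) → var (suc (suc i)) })
          (λ ρ → head ρ ∷ tail (tail ρ))
          (λ { (v ∷ x ∷ ρ) zero    → sym (⊕-identityʳ v)
             ; (v ∷ x ∷ ρ) (suc i) → sym (⊕-identityʳ (lookup ρ i)) })
          (definable-colour cs j m))))
  where
  hit = definable-≡ (suc zero) (zero , j)
  cases : ∀ v x ρ →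
    ((x ≡ v ⊕ j × just c ≡ m) ⊎ (x ≢ v ⊕ j × paint cs ρ (v ⊕ j) ≡ m))
    ⇔ (paint (c ∷ cs) (x ∷ ρ) (v ⊕ j) ≡ m)
  cases v x ρ with (v ⊕ j) ≟ᶜ x
  ... | yes v⊕j≡x =
    mk⇔ [ (λ (_ , e) → e) , (λ (x≢ , _) → contradiction (sym v⊕j≡x) x≢) ]′
        (λ e → inj₁ (sym v⊕j≡x , e))
  ... | no  v⊕j≢x =
    mk⇔ [ (λ (x≡ , _) → contradiction (sym x≡) v⊕j≢x) , (λ (_ , e) → e) ]′
        (λ e → inj₂ (v⊕j≢x ∘ sym , e))

definable-uncoloured : (cs : Vec (Fin k) n) →
  Definable {d} λ ρ → paint cs (tail ρ) (head ρ) ≡ nothing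
definable-uncoloured cs =
  definable-⇔
    (λ { (x ∷ ρ) → subst (λ y → (paint cs ρ (x ⊕ 𝟎) ≡ nothing) ⇔ (paint cs ρ y ≡ nothing))
                         (⊕-identityʳ x) (⇔-id _) })
    (definable-colour cs 𝟎 nothing)

module _ {d k : ℕ} (ℱ : List (FinitePattern (suc d) (Fin k))) where
  open Γ (Fin k) ℱ U

  definable-Final : (cs : Vec (Fin k) n) → Definable λ ρ → Final (paint cs ρ)
  definable-Final cs =
    definable-Any
      (λ q → definable-∃ (definable-All (λ (j , c) → definable-colour cs j (just c)) (graph q)))
      ℱ

  -- Under a quantifier the environment is a variable, so `paint (c ∷ cs)` unfolds only once that
  -- environment is split into head and tail.
  definable-[≔] : (P : Pred (Pattern (suc d) (Fin k)) 0ℓ) (cs : Vec (Fin k) n) →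
    ∀ c → Definable (λ ρ → P (paint (c ∷ cs) ρ)) →
    Definable λ ρ → P (paint cs (tail ρ) [ head ρ ≔ c ])
  definable-[≔] P cs c = definable-⇔ λ { (_ ∷ _) → ⇔-id _ }

  -- The induction on `T` must range over all `cs`, since each colouring move adds a cell variable.
  -- The disjunct `Final` is present at every bound because `final` satisfies all of them.
  definable-Value≤ : ∀ T player (cs : Vec (Fin k) n) →
    Definable λ ρ → Value≤ T (paint cs ρ , player)
  definable-Value≤ zero player cs =
    definable-⇔ (λ _ → mk⇔ final λ { (final f) → f }) (definable-Final cs)
  definable-Value≤ (suc T) A cs =
    definable-⇔
      (λ _ → mk⇔
        (λ { (inj₁ f)                               → final f
           ; (inj₂ (inj₁ w))                        → moveA pass w
           ; (inj₂ (inj₂ (x , uncoloured , c , w))) → moveA (colour x c tt uncoloured) w })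
        (λ { (final f)                           → inj₁ f
           ; (moveA pass w)                      → inj₂ (inj₁ w)
           ; (moveA (colour x c _ uncoloured) w) → inj₂ (inj₂ (x , uncoloured , c , w)) }))
      (definable-⊎ (definable-Final cs)
      (definable-⊎ (definable-Value≤ T B cs)
      (definable-∃ (definable-× (definable-uncoloured cs)
        (definable-∃Fin λ c →
          definable-[≔] (λ p → Value≤ T (p , B)) cs c (definable-Value≤ T B (c ∷ cs)))))))
  definable-Value≤ (suc T) B cs =
    definable-⇔
      (λ _ → mk⇔
        (λ { (inj₁ f)        → final f
           ; (inj₂ (w , ws)) → moveB λ
               { pass → w ; (colour x c _ uncoloured) → ws x uncoloured c } })
        (λ { (final f)  → inj₁ f
           ; (moveB ws) → inj₂ (ws pass , λ x uncoloured c → ws (colour x c tt uncoloured)) }))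
      (definable-⊎ (definable-Final cs)
      (definable-× (definable-Value≤ T A cs)
      (definable-∀ (definable-→ (definable-uncoloured cs)
        (definable-∀Fin λ c →
          definable-[≔] (λ p → Value≤ T (p , A)) cs c (definable-Value≤ T A (c ∷ cs)))))))

theorem2 : (d : ℕ) → d ≥ 1 →
    (k : ℕ) (ℱ : List (FinitePattern d (Fin k))) (T : ℕ) →
    Dec (Γ.AWinsWithin (Fin k) ℱ U T)
-- The initial position has no coloured cells, so its formula has no variables and is evaluated at
-- `[]`.
theorem2 (suc d) (s≤s _) k ℱ T = decide (definable-Value≤ ℱ T A []) []
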